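{- Let $D$ be the formal derivative of the context-free grammar $G=\{x\rightarrow xy,\ y\rightarrow yz,\ z\rightarrow y^2\}$, i.e. the derivation on polynomials in the commuting indeterminates $x,y,z$ determined by $D(x)=xy$, $D(y)=yz$, $D(z)=y^2$. Then for every integer $n\ge 1$, $$D^{n}(x^2)=x^2\sum_{k=1}^{n}R(n+1,k)\,y^kz^{n-k}$$ and $$D^n(x)=x\sum_{k=1}^n a_k(n)\,y^kz^{n-k}.$$
   Context: $\mathfrak{S}_n$ is the set of permutations $\pi=\pi(1)\cdots\pi(n)$ of $\{1,\ldots,n\}$. A permutation $\pi\in\mathfrak{S}_n$ changes direction at position $i\in\{2,\ldots,n-1\}$ if $\pi(i-1)<\pi(i)>\pi(i+1)$ or $\pi(i-1)>\pi(i)<\pi(i+1)$. For $n\ge 2$, $\pi$ has $k$ alternating runs if it changes direction at exactly $k-1$ positions, and $R(n,k)$ is the number of permutations in $\mathfrak{S}_n$ with $k$ alternating runs. An alternating subsequence of $\pi$ of length $k$ is a subsequence $\pi(i_1),\ldots,\pi(i_k)$ with $i_1<\cdots<i_k$ and $\pi(i_1)>\pi(i_2)<\pi(i_3)>\cdots\pi(i_k)$ (starting with a descent and alternating thereafter; any sequence of length 1 qualifies). $\mathrm{as}(\pi)$ is the maximal length of an alternating subsequence of $\pi$, and $a_k(n)=\#\{\pi\in\mathfrak{S}_n:\mathrm{as}(\pi)=k\}$. The formal derivative $D$ of a grammar is the linear operator satisfying the Leibniz rule $D(uv)=D(u)v+uD(v)$ that sends each letter to the expression it is replaced by; $D^n$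 denotes the $n$-fold iterate. -}

module Defs where

open import Algebra.Bundles using (CommutativeRing; CommutativeSemiring)
import Algebra.Definitions.RawSemiring as RawSemiringDefinitions
import Algebra.Solver.Ring.NaturalCoefficients.Default as SemiringSolver
open import Data.Fin.Base using (Fin; suc; toℕ; inject₁; _<_; _>_)
import Data.Fin.Properties as Fin
open import Data.Integer.Base as ℤ using (ℤ; 0ℤ; 1ℤ; -1ℤ; +_)
import Data.Integer.Properties as ℤ
open import Data.List.Base
  using (List; []; _∷_; [_]; map; _++_; filter; length; allFin; cartesianProductWith)
open import Data.List.Extrema.Nat using (max)
open import Data.List.Membership.Propositional using (_∈_)
open import Data.List.Membership.Propositional.Properties
  using (∈-map⁺; ∈-map⁻; ∈-++⁺ˡ; ∈-++⁺ʳ; ∈-++⁻)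
open import Data.List.Relation.Binary.Sublist.Propositional using (_⊆_; []; _∷_; _∷ʳ_)
open import Data.List.Relation.Unary.Any using (here)
open import Data.Nat.Base using (ℕ; zero; suc)
import Data.Nat.GeneralisedArithmetic as ℕ
import Data.Nat.Properties as ℕ
open import Data.Product.Base using (_×_; _,_)
open import Data.Sum.Base using (_⊎_; inj₁; inj₂)
open import Data.Unit.Base using (⊤; tt)
open import Data.Vec.Base using (Vec; []; _∷_; lookup; toList)
open import Data.Vec.Relation.Unary.AllPairs using (allPairs?)
open import Level using (0ℓ)
open import Relation.Binary.PropositionalEquality
  using (_≡_; refl; sym; trans; cong₂)
open import Relation.Nullary.Decidable using (yes; _×-dec_; _⊎-dec_; ¬?)
open import Relation.Unary using (Decidable)

-- The polynomial ring ℤ[X] in commuting indeterminates X, as the free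
-- commutative ℤ-algebra on X: expressions modulo the least congruence
-- containing the commutative ring laws and the arithmetic of constants.

infixl 6 _:+_
infixl 7 _:*_
infix  4 _≋_

data ℤ[_] (X : Set) : Set where
  con       : ℤ → ℤ[ X ]
  var       : X → ℤ[ X ]
  _:+_ _:*_ : ℤ[ X ] → ℤ[ X ] → ℤ[ X ]

data _≋_ {X : Set} : ℤ[ X ] → ℤ[ X ] → Set where
  ≋-refl       : ∀ {p} → p ≋ p
  ≋-sym        : ∀ {p q} → p ≋ q → q ≋ p
  ≋-trans      : ∀ {p q r} → p ≋ q → q ≋ r → p ≋ r
  :+-cong      : ∀ {p p′ q q′} → p ≋ p′ → q ≋ q′ → p :+ q ≋ p′ :+ q′
  :*-cong      : ∀ {p p′ q q′} → p ≋ p′ → q ≋ q′ → p :* q ≋ p′ :* q′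
  :+-assoc     : ∀ p q r → (p :+ q) :+ r ≋ p :+ (q :+ r)
  :+-comm      : ∀ p q → p :+ q ≋ q :+ p
  :+-identityˡ : ∀ p → con 0ℤ :+ p ≋ p
  :*-assoc     : ∀ p q r → (p :* q) :* r ≋ p :* (q :* r)
  :*-comm      : ∀ p q → p :* q ≋ q :* p
  :*-identityˡ : ∀ p → con 1ℤ :* p ≋ p
  :*-zeroˡ     : ∀ p → con 0ℤ :* p ≋ con 0ℤ
  distribʳ     : ∀ p q r → (q :+ r) :* p ≋ q :* p :+ r :* p
  con-+        : ∀ a b → con (a ℤ.+ b) ≋ con a :+ con b
  con-*        : ∀ a b → con (a ℤ.* b) ≋ con a :* con b

polynomialRing : Set → CommutativeRing 0ℓ 0ℓ
polynomialRing X = record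
  { Carrier = ℤ[ X ]
  ; _≈_     = _≋_
  ; _+_     = _:+_
  ; _*_     = _:*_
  ; -_      = con -1ℤ :*_
  ; 0#      = con 0ℤ
  ; 1#      = con 1ℤ
  ; isCommutativeRing = record
    { isRing = record
      { +-isAbelianGroup = record
        { isGroup = record
          { isMonoid = record
            { isSemigroup = record
              { isMagma = record
                { isEquivalence = record { refl = ≋-refl ; sym = ≋-sym ; trans = ≋-trans }
                ; ∙-cong        = :+-cong
                }
              ; assoc = :+-assoc
              }
            ; identity = :+-identityˡ
                       , λ p → ≋-trans (:+-comm p _) (:+-identityˡ p)
            }
          ; inverse = inverseˡ , λ p → ≋-trans (:+-comm p _) (inverseˡ p)
          ; ⁻¹-cong = :*-cong ≋-refl
          }
        ; comm = :+-comm
        }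
      ; *-cong     = :*-cong
      ; *-assoc    = :*-assoc
      ; *-identity = :*-identityˡ , λ p → ≋-trans (:*-comm p _) (:*-identityˡ p)
      ; distrib    = distribˡ , distribʳ
      }
    ; *-comm = :*-comm
    }
  }
  where
  inverseˡ : ∀ p → con -1ℤ :* p :+ p ≋ con 0ℤ
  inverseˡ p =
    ≋-trans (:+-cong ≋-refl (≋-sym (:*-identityˡ p)))
    (≋-trans (≋-sym (distribʳ p _ _))
    (≋-trans (:*-cong (≋-sym (con-+ -1ℤ 1ℤ)) ≋-refl) (:*-zeroˡ p)))

  distribˡ : ∀ p q r → p :* (q :+ r) ≋ p :* q :+ p :* r
  distribˡ p q r =
    ≋-trans (:*-comm p _)
    (≋-trans (distribʳ p q r) (:+-cong (:*-comm q p) (:*-comm r p)))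

-- Evaluation at integer points respects _≋_, so the congruence identifies
-- only expressions that denote the same polynomial.

eval : ∀ {X} → (X → ℤ) → ℤ[ X ] → ℤ
eval ρ (con c)  = c
eval ρ (var v)  = ρ v
eval ρ (p :+ q) = eval ρ p ℤ.+ eval ρ q
eval ρ (p :* q) = eval ρ p ℤ.* eval ρ q

eval-cong : ∀ {X} (ρ : X → ℤ) {p q} → p ≋ q → eval ρ p ≡ eval ρ q
eval-cong ρ ≋-refl           = refl
eval-cong ρ (≋-sym e)        = sym (eval-cong ρ e)
eval-cong ρ (≋-trans e f)    = trans (eval-cong ρ e) (eval-cong ρ f)
eval-cong ρ (:+-cong e f)    = cong₂ ℤ._+_ (eval-cong ρ e) (eval-cong ρ f)
eval-cong ρ (:*-cong e f)    = cong₂ ℤ._*_ (eval-cong ρ e) (eval-cong ρ f)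
eval-cong ρ (:+-assoc p q r) = ℤ.+-assoc (eval ρ p) (eval ρ q) (eval ρ r)
eval-cong ρ (:+-comm p q)    = ℤ.+-comm (eval ρ p) (eval ρ q)
eval-cong ρ (:+-identityˡ p) = ℤ.+-identityˡ (eval ρ p)
eval-cong ρ (:*-assoc p q r) = ℤ.*-assoc (eval ρ p) (eval ρ q) (eval ρ r)
eval-cong ρ (:*-comm p q)    = ℤ.*-comm (eval ρ p) (eval ρ q)
eval-cong ρ (:*-identityˡ p) = ℤ.*-identityˡ (eval ρ p)
eval-cong ρ (:*-zeroˡ p)     = ℤ.*-zeroˡ (eval ρ p)
eval-cong ρ (distribʳ p q r) = ℤ.*-distribʳ-+ (eval ρ p) (eval ρ q) (eval ρ r)
eval-cong ρ (con-+ a b)      = refl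
eval-cong ρ (con-* a b)      = refl

-- The formal derivative of a grammar. It is ℤ-linear because constants are
-- sent to 0, and derivative-cong makes it a map of the polynomial ring.

Grammar : Set → Set
Grammar X = X → ℤ[ X ]

derivative : ∀ {X} → Grammar X → ℤ[ X ] → ℤ[ X ]
derivative G (con c)  = con 0ℤ
derivative G (var v)  = G v
derivative G (p :+ q) = derivative G p :+ derivative G q
derivative G (p :* q) = derivative G p :* q :+ p :* derivative G q

derivative-cong : ∀ {X} (G : Grammar X) {p q} →
                  p ≋ q → derivative G p ≋ derivative G q
derivative-cong {X} G = d-cong
  where
  open CommutativeRing (polynomialRing X) using (commutativeSemiring)
  module S = SemiringSolver commutativeSemiring
  d = derivative G

  d-cong : ∀ {p q} → p ≋ q → d p ≋ d q
  d-cong ≋-refl           = ≋-refl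
  d-cong (≋-sym e)        = ≋-sym (d-cong e)
  d-cong (≋-trans e f)    = ≋-trans (d-cong e) (d-cong f)
  d-cong (:+-cong e f)    = :+-cong (d-cong e) (d-cong f)
  d-cong (:*-cong e f)    = :+-cong (:*-cong (d-cong e) f) (:*-cong e (d-cong f))
  d-cong (:+-assoc p q r) = :+-assoc (d p) (d q) (d r)
  d-cong (:+-comm p q)    = :+-comm (d p) (d q)
  d-cong (:+-identityˡ p) = :+-identityˡ (d p)
  d-cong (:*-assoc p q r) =
    S.solve 6 (λ p q r p′ q′ r′ →
        (p′ S.:* q S.:+ p S.:* q′) S.:* r S.:+ (p S.:* q) S.:* r′ S.:=
        p′ S.:* (q S.:* r) S.:+ p S.:* (q′ S.:* r S.:+ q S.:* r′))
      ≋-refl p q r (d p) (d q) (d r)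
  d-cong (:*-comm p q) =
    S.solve 4 (λ p q p′ q′ →
        p′ S.:* q S.:+ p S.:* q′ S.:= q′ S.:* p S.:+ q S.:* p′)
      ≋-refl p q (d p) (d q)
  d-cong (:*-identityˡ p) =
    S.solve 2 (λ p p′ → S.con 0 S.:* p S.:+ S.con 1 S.:* p′ S.:= p′) ≋-refl p (d p)
  d-cong (:*-zeroˡ p) =
    S.solve 2 (λ p p′ → S.con 0 S.:* p S.:+ S.con 0 S.:* p′ S.:= S.con 0) ≋-refl p (d p)
  d-cong (distribʳ p q r) =
    S.solve 6 (λ p q r p′ q′ r′ →
        (q′ S.:+ r′) S.:* p S.:+ (q S.:+ r) S.:* p′ S.:=
        (q′ S.:* p S.:+ q S.:* p′) S.:+ (r′ S.:* p S.:+ r S.:* p′))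
      ≋-refl p q r (d p) (d q) (d r)
  d-cong (con-+ a b) = ≋-sym (:+-identityˡ _)
  d-cong (con-* a b) =
    S.solve 2 (λ a b → S.con 0 S.:= S.con 0 S.:* b S.:+ a S.:* S.con 0)
      ≋-refl (con a) (con b)

data Letter : Set where
  X Y Z : Letter

x y z : ℤ[ Letter ]
x = var X
y = var Y
z = var Z

open CommutativeRing (polynomialRing Letter) public using (_≈_; _+_; _*_)
open RawSemiringDefinitions
  (CommutativeSemiring.rawSemiring (CommutativeRing.commutativeSemiring (polynomialRing Letter))) public
  using (_^_; sum)

G : Grammar Letter
G X = x * y
G Y = y * z
G Z = y ^ 2

D : ℤ[ Letter ] → ℤ[ Letter ]
D = derivative G

D^[_] : ℕ → ℤ[ Letter ] → ℤ[ Letter ]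
D^[ n ] p = ℕ.fold p D n

⟦_⟧ : ℕ → ℤ[ Letter ]
⟦ m ⟧ = con (+ m)

infixl 6 ∑[1≤k≤_]_

∑[1≤k≤_]_ : ℕ → (ℕ → ℤ[ Letter ]) → ℤ[ Letter ]
∑[1≤k≤ n ] f = sum {n} (λ i → f (suc (toℕ i)))

-- Permutations in one-line notation, with values and positions counted from 0.

Word : ℕ → ℕ → Set
Word m n = Vec (Fin m) n

words : ∀ m n → List (Word m n)
words m zero    = [ [] ]
words m (suc n) = cartesianProductWith _∷_ (allFin m) (words m n)

𝔖 : ∀ n → List (Word n n)
𝔖 n = filter (allPairs? λ i j → ¬? (i Fin.≟ j)) (words n n)

count : ∀ {A : Set} {P : A → Set} → Decidable P → List A → ℕ
count P? as = length (filter P? as)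

-- The interior positions 2,…,n+1 of a word of length n+2 are indexed by
-- i : Fin n; the three values looked up are those at positions i+1, i+2, i+3
-- counted from 1.

ChangesDirection : ∀ {m n} → Word m (suc (suc n)) → Fin n → Set
ChangesDirection π i = (l < c × c > r) ⊎ (l > c × c < r)
  where
  l = lookup π (inject₁ (inject₁ i))
  c = lookup π (suc (inject₁ i))
  r = lookup π (suc (suc i))

changesDirection? : ∀ {m n} (π : Word m (suc (suc n))) → Decidable (ChangesDirection π)
changesDirection? π i =
  (_ Fin.<? _ ×-dec _ Fin.<? _) ⊎-dec (_ Fin.<? _ ×-dec _ Fin.<? _)

alternatingRuns : ∀ {m n} → Word m (suc (suc n)) → ℕ
alternatingRuns {n = n} π = suc (count (changesDirection? π) (allFin n))

-- Alternating runs are only defined for n ≥ 2; the first two values are dummies.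

R : ℕ → ℕ → ℕ
R 0                 k = 0
R 1                 k = 0
R n@(suc (suc _))   k = count (λ π → alternatingRuns π ℕ.≟ k) (𝔖 n)

-- Falling: a₁ > a₂ < a₃ > ⋯;  Rising: a₁ < a₂ > a₃ < ⋯.

Falling Rising : ∀ {m} → List (Fin m) → Set
Falling []           = ⊤
Falling (a ∷ [])     = ⊤
Falling (a ∷ b ∷ as) = a > b × Rising (b ∷ as)
Rising []            = ⊤
Rising (a ∷ [])      = ⊤
Rising (a ∷ b ∷ as)  = a < b × Falling (b ∷ as)

falling? : ∀ {m} → Decidable (Falling {m})
rising?  : ∀ {m} → Decidable (Rising {m})
falling? []           = yes tt
falling? (a ∷ [])     = yes tt
falling? (a ∷ b ∷ as) = b Fin.<? a ×-dec rising? (b ∷ as)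
rising? []            = yes tt
rising? (a ∷ [])      = yes tt
rising? (a ∷ b ∷ as)  = a Fin.<? b ×-dec falling? (b ∷ as)

subsequences : ∀ {A : Set} → List A → List (List A)
subsequences []       = [ [] ]
subsequences (a ∷ as) = map (a ∷_) (subsequences as) ++ subsequences as

∈-subsequences⁺ : ∀ {A : Set} {as bs : List A} → as ⊆ bs → as ∈ subsequences bs
∈-subsequences⁺ []         = here refl
∈-subsequences⁺ (b ∷ʳ s)   = ∈-++⁺ʳ _ (∈-subsequences⁺ s)
∈-subsequences⁺ (refl ∷ s) = ∈-++⁺ˡ (∈-map⁺ _ (∈-subsequences⁺ s))

∈-subsequences⁻ : ∀ {A : Set} {as : List A} bs → as ∈ subsequences bs → as ⊆ bs
∈-subsequences⁻ []       (here refl) = []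
∈-subsequences⁻ (b ∷ bs) as∈ with ∈-++⁻ (map (b ∷_) (subsequences bs)) as∈
... | inj₂ as∈bs = b ∷ʳ ∈-subsequences⁻ bs as∈bs
... | inj₁ as∈b∷ with ∈-map⁻ (b ∷_) as∈b∷
...   | _ , as∈bs , refl = refl ∷ ∈-subsequences⁻ bs as∈bs

as : ∀ {m n} → Word m n → ℕ
as π = max 0 (map length (filter falling? (subsequences (toList π))))

-- a k n is the number a_k(n).

a : ℕ → ℕ → ℕ
a k n = count (λ π → as π ℕ.≟ k) (𝔖 n)

-- Give a word π the weight w(π) with one letter for each step between consecutive
-- values: y if the step changes direction and z otherwise. The first step counts as a
-- turn for alternating runs. For as(π) the word is entered by an imaginary ascent, and
-- this entry contributes a further y. Thus the exponent of y in w(π) is the number of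
-- runs, respectively as(π).
-- Inserting a new minimum into π at every position multiplies or replaces letters the
-- way the grammar does: the weights of the resulting words sum to D(w(π)) + q w(π),
-- with q = 2y for runs and q = y for as. These are the factors produced by
-- D(x²) = 2y x² and D(x) = y x, so Dⁿ(x²) and Dⁿ(x) are x² and x times the sum of the
-- weights of all permutations.

module Submission where

open import Defs
open import Data.Nat.Base using (ℕ; suc; _≥_; _∸_)
open import Data.Product.Base using (_×_)

open import Algebra.Bundles using (CommutativeRing)
import Algebra.Properties.CommutativeMonoid.Sum as CommutativeMonoidSum
import Algebra.Properties.Semiring.Exp as SemiringExp
import Algebra.Solver.Ring.NaturalCoefficients.Default as SemiringSolver
open import Data.Bool.Base using (if_then_else_; true; false)
open import Data.Fin.Base using (Fin; zero; suc; toℕ; fromℕ<)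
import Data.Fin.Properties as Fin
import Data.Integer.Base as ℤ
open import Data.List.Base
  using (List; []; _∷_; [_]; map; _++_; filter; length; allFin; concatMap; foldr; tabulate)
open import Data.List.Extrema.Nat using (max≈v⁺)
open import Data.List.Membership.Propositional using (_∈_; find; lose)
open import Data.List.Membership.Propositional.Properties
  using ( ∈-map⁺; ∈-map⁻; ∈-filter⁺; ∈-filter⁻; ∈-allFin; ∈-concatMap⁺; ∈-concatMap⁻
        ; ∈-cartesianProductWith⁺)
open import Data.List.Membership.Propositional.Properties.WithK using (unique∧set⇒bag)
open import Data.List.Properties using (map-tabulate)
open import Data.List.Relation.Binary.BagAndSetEquality using (∼bag⇒↭)
open import Data.List.Relation.Binary.Disjoint.Propositional using (Disjoint)
open import Data.List.Relation.Binary.Permutation.Propositional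
  using (_↭_; refl; prep; swap; trans)
open import Data.List.Relation.Binary.Sublist.Propositional using (_⊆_; []; _∷_; _∷ʳ_)
open import Data.List.Relation.Binary.Sublist.Propositional.Properties using (∷ˡ⁻; length-mono-≤)
open import Data.List.Relation.Unary.All as ListAll using ([])
import Data.List.Relation.Unary.All.Properties as ListAll
open import Data.List.Relation.Unary.AllPairs as AllPairs using ([]; _∷_)
import Data.List.Relation.Unary.AllPairs.Properties as AllPairs
open import Data.List.Relation.Unary.Any using (here; there)
import Data.List.Relation.Unary.Unique.Propositional as List
import Data.List.Relation.Unary.Unique.Propositional.Properties as List
import Data.Nat.Base as ℕ
import Data.Nat.Properties as ℕ
open import Data.Product.Base using (_,_; ∃; ∃₂; proj₁; proj₂)
open import Data.Sum.Base using (inj₁; inj₂)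
open import Data.Unit.Base using (tt)
open import Data.Vec.Base as Vec using (Vec; []; _∷_; lookup; toList)
import Data.Vec.Properties as Vec
open import Data.Vec.Relation.Unary.All as All using (All; []; _∷_)
import Data.Vec.Relation.Unary.All.Properties as All
open import Data.Vec.Relation.Unary.AllPairs using (allPairs?; []; _∷_)
import Data.Vec.Relation.Unary.AllPairs as VecAllPairs
import Data.Vec.Relation.Unary.AllPairs.Properties as VecAllPairs
open import Data.Vec.Relation.Unary.Unique.Propositional using (Unique)
open import Data.Vec.Relation.Unary.Unique.Propositional.Properties using (lookup-injective)
open import Function.Base using (_∘_; id)
open import Function.Bundles using (mk⇔)
open import Relation.Binary.PropositionalEquality as ≡ using (_≡_; _≢_; cong; cong₂; sym)
import Relation.Binary.Reasoning.Setoid as SetoidReasoning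
open import Relation.Nullary.Decidable using (Dec; does; dec-true; dec-false; ¬?)
open import Relation.Nullary.Negation using (¬_; contradiction)
open import Relation.Nullary.Reflects using (ofʸ; ofⁿ)
open import Relation.Unary using (Decidable)

open CommutativeRing (polynomialRing Letter)
  using ( setoid; semiring; commutativeSemiring; +-commutativeMonoid; +-cong; +-congˡ; +-congʳ
        ; +-assoc; +-identityˡ; *-cong; *-congˡ; *-congʳ; *-assoc; *-identityˡ; zeroˡ; zeroʳ; distribˡ)
  renaming (refl to ≈-refl; sym to ≈-sym; trans to ≈-trans; reflexive to ≈-reflexive)
open CommutativeMonoidSum +-commutativeMonoid using (sum-cong-≋; ∑-distrib-+)
open SemiringExp semiring using (^-homo-*)
open SemiringSolver commutativeSemiring using (solve; _:=_; con; _:^_)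
  renaming (_:+_ to _⊕_; _:*_ to _⊛_)
open SetoidReasoning setoid

private
  variable
    A B : Set
    m n : ℕ

-- Finite sums of polynomials over lists.

∑ : (A → ℤ[ Letter ]) → List A → ℤ[ Letter ]
∑ f = foldr (λ v s → f v + s) ⟦ 0 ⟧

∑-cong : ∀ {f g : A → ℤ[ Letter ]} vs → (∀ {v} → v ∈ vs → f v ≈ g v) → ∑ f vs ≈ ∑ g vs
∑-cong []       f≈g = ≈-refl
∑-cong (v ∷ vs) f≈g = +-cong (f≈g (here ≡.refl)) (∑-cong vs (f≈g ∘ there))

∑-map : ∀ (f : B → ℤ[ Letter ]) (h : A → B) vs → ∑ f (map h vs) ≡ ∑ (f ∘ h) vs
∑-map f h []       = ≡.refl
∑-map f h (v ∷ vs) = cong (f (h v) +_) (∑-map f h vs)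

∑-++ : ∀ (f : A → ℤ[ Letter ]) us vs → ∑ f (us ++ vs) ≈ ∑ f us + ∑ f vs
∑-++ f []       vs = ≈-sym (+-identityˡ _)
∑-++ f (u ∷ us) vs = ≈-trans (+-congˡ (∑-++ f us vs)) (≈-sym (+-assoc _ _ _))

∑-concatMap : ∀ (f : B → ℤ[ Letter ]) (h : A → List B) vs →
              ∑ f (concatMap h vs) ≈ ∑ (∑ f ∘ h) vs
∑-concatMap f h []       = ≈-refl
∑-concatMap f h (v ∷ vs) = ≈-trans (∑-++ f (h v) _) (+-congˡ (∑-concatMap f h vs))

∑-↭ : ∀ (f : A → ℤ[ Letter ]) {us vs} → us ↭ vs → ∑ f us ≈ ∑ f vs
∑-↭ f refl         = ≈-refl
∑-↭ f (prep v σ)   = +-congˡ (∑-↭ f σ)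
∑-↭ f (swap u v σ) = ≈-trans (+-congˡ (+-congˡ (∑-↭ f σ)))
  (solve 3 (λ p q r → p ⊕ (q ⊕ r) := q ⊕ (p ⊕ r)) ≈-refl _ _ _)
∑-↭ f (trans σ τ)  = ≈-trans (∑-↭ f σ) (∑-↭ f τ)

*-distribˡ-∑ : ∀ p (f : A → ℤ[ Letter ]) vs → p * ∑ f vs ≈ ∑ (λ v → p * f v) vs
*-distribˡ-∑ p f []       = zeroʳ p
*-distribˡ-∑ p f (v ∷ vs) = ≈-trans (distribˡ _ _ _) (+-congˡ (*-distribˡ-∑ p f vs))

-- Both `D` and multiplication by `p` are additive. This carries the insertion rule from single
-- permutations to the sum over all of them.
D-∑ : ∀ p (f : A → ℤ[ Letter ]) vs →
      ∑ (λ v → D (f v) + p * f v) vs ≈ D (∑ f vs) + p * ∑ f vs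
D-∑ p f []       = solve 1 (λ p → con 0 := con 0 ⊕ p ⊛ con 0) ≈-refl p
D-∑ p f (v ∷ vs) = ≈-trans (+-congˡ (D-∑ p f vs))
  (solve 5 (λ p v v′ s s′ → (v′ ⊕ p ⊛ v) ⊕ (s′ ⊕ p ⊛ s) := (v′ ⊕ s′) ⊕ p ⊛ (v ⊕ s))
    ≈-refl p (f v) (D (f v)) (∑ f vs) (D (∑ f vs)))

-- Grouping a sum by the values of a statistic.

indicator : {P : Set} → Dec P → ℕ
indicator P? = if does P? then 1 else 0

count-∷ : ∀ {P : A → Set} (P? : Decidable P) v vs →
          count P? (v ∷ vs) ≡ indicator (P? v) ℕ.+ count P? vs
count-∷ P? v vs with does (P? v)
... | true  = ≡.refl
... | false = ≡.refl

count-map : ∀ {P : B → Set} (P? : Decidable P) (f : A → B) vs →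
            count P? (map f vs) ≡ count (P? ∘ f) vs
count-map P? f []       = ≡.refl
count-map P? f (v ∷ vs) = ≡.trans (count-∷ P? (f v) (map f vs))
  (≡.trans (cong (indicator (P? (f v)) ℕ.+_) (count-map P? f vs))
           (sym (count-∷ (P? ∘ f) v vs)))

sum-zero : ∀ (f : Fin n → ℤ[ Letter ]) → sum (λ i → ⟦ 0 ⟧ * f i) ≈ ⟦ 0 ⟧
sum-zero {ℕ.zero} f = ≈-refl
sum-zero {suc n}  f = ≈-trans (+-cong (zeroˡ _) (sum-zero (f ∘ suc))) (+-identityˡ _)

-- The Kronecker delta: the indicator selects the single index `j`.
sum-indicator : ∀ (f : Fin n → ℤ[ Letter ]) j →
                sum (λ i → ⟦ indicator (toℕ j ℕ.≟ toℕ i) ⟧ * f i) ≈ f j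
sum-indicator f zero    = ≈-trans (+-cong (*-identityˡ _) (sum-zero (f ∘ suc)))
  (solve 1 (λ p → p ⊕ con 0 := p) ≈-refl _)
sum-indicator f (suc j) = ≈-trans (+-cong (zeroˡ _) (sum-indicator (f ∘ suc) j)) (+-identityˡ _)

-- Each list element is spread out as a sum over all `k` against an indicator; adding the indicators
-- for one `k` over the list gives the coefficient. The range hypothesis ensures that every value
-- meets some index of the sum.
∑-by-value : ∀ n (F : ℕ → ℤ[ Letter ]) (s : A → ℕ) vs →
             (∀ {v} → v ∈ vs → ∃ λ (j : Fin n) → s v ≡ suc (toℕ j)) →
             ∑ (F ∘ s) vs ≈ (∑[1≤k≤ n ] λ k → ⟦ count (λ v → s v ℕ.≟ k) vs ⟧ * F k)
∑-by-value n F s []       range = ≈-sym (sum-zero {n} (λ i → F (suc (toℕ i))))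
∑-by-value n F s (v ∷ vs) range with j , sv≡ ← range (here ≡.refl) = begin
  F (s v) + ∑ (F ∘ s) vs
    ≈⟨ +-cong (≈-sym (≈-trans (sum-indicator (λ i → F (suc (toℕ i))) j)
                              (≈-reflexive (cong F (sym sv≡)))))
              (∑-by-value n F s vs (range ∘ there)) ⟩
  sum {n} (λ i → ⟦ indicator (toℕ j ℕ.≟ toℕ i) ⟧ * F (suc (toℕ i))) +
  sum {n} (λ i → ⟦ count (s? i) vs ⟧ * F (suc (toℕ i)))
    ≈⟨ ∑-distrib-+ {n} _ _ ⟨
  sum {n} (λ i → ⟦ indicator (toℕ j ℕ.≟ toℕ i) ⟧ * F (suc (toℕ i)) +
                 ⟦ count (s? i) vs ⟧ * F (suc (toℕ i)))
    ≈⟨ sum-cong-≋ (λ i → ≈-trans (≈-sym (distribʳ _ _ _))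
         (*-congʳ (≈-trans (≈-sym (con-+ (ℤ.+ _) (ℤ.+ _)))
           (≈-reflexive (cong ⟦_⟧ (count-cons i)))))) ⟩
  sum {n} (λ i → ⟦ count (s? i) (v ∷ vs) ⟧ * F (suc (toℕ i)))
    ∎
  where
  s? : ∀ (i : Fin n) → Decidable (λ v → s v ≡ suc (toℕ i))
  s? i v = s v ℕ.≟ suc (toℕ i)
  count-cons : ∀ (i : Fin n) → indicator (toℕ j ℕ.≟ toℕ i) ℕ.+ count (s? i) vs
                             ≡ count (s? i) (v ∷ vs)
  -- Comparing two successors computes to the same Boolean as comparing their predecessors, so
  -- rewriting by `sv≡` suffices.
  count-cons i = sym (≡.trans (count-∷ (s? i) v vs)
    (cong (λ t → indicator (t ℕ.≟ suc (toℕ i)) ℕ.+ count (s? i) vs) sv≡))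

-- Inserting a new minimum into a permutation

insertions : A → Vec A n → List (Vec A (suc n))
insertions v []       = [ v ∷ [] ]
insertions v (u ∷ us) = (v ∷ u ∷ us) ∷ map (u ∷_) (insertions v us)

raise : Word m n → Word (suc m) n
raise = Vec.map suc

insertMin : Word m n → List (Word (suc m) (suc n))
insertMin π = insertions zero (raise π)

insertions-All⁺ : ∀ {P : A → Set} {v} (us : Vec A n) {ws} →
                  ws ∈ insertions v us → P v → All P us → All P ws
insertions-All⁺ []       (here ≡.refl) pv []         = pv ∷ []
insertions-All⁺ (u ∷ us) (here ≡.refl) pv pus        = pv ∷ pus
insertions-All⁺ (u ∷ us) (there ws∈)   pv (pu ∷ pus)
  with _ , ws′∈ , ≡.refl ← ∈-map⁻ (u ∷_) ws∈ = pu ∷ insertions-All⁺ us ws′∈ pv pus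

insertions-All⁻ : ∀ {P : A → Set} {v} (us : Vec A n) {ws} →
                  ws ∈ insertions v us → All P ws → P v × All P us
insertions-All⁻ []       (here ≡.refl) (pv ∷ [])  = pv , []
insertions-All⁻ (u ∷ us) (here ≡.refl) (pv ∷ pus) = pv , pus
insertions-All⁻ (u ∷ us) (there ws∈)   pws
  with _ , ws′∈ , ≡.refl ← ∈-map⁻ (u ∷_) ws∈ | pu ∷ pws′ ← pws
  with pv , pus ← insertions-All⁻ us ws′∈ pws′ = pv , pu ∷ pus

insertions-distinct⁺ : ∀ {v} (us : Vec A n) {ws} → ws ∈ insertions v us →
                      All (v ≢_) us → Unique us → Unique ws
insertions-distinct⁺ []       (here ≡.refl) []           []         = [] ∷ []
insertions-distinct⁺ (u ∷ us) (here ≡.refl) v∉us         us!        = v∉us ∷ us!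
insertions-distinct⁺ (u ∷ us) (there ws∈)   (v≢u ∷ v∉us) (u∉us ∷ us!)
  with _ , ws′∈ , ≡.refl ← ∈-map⁻ (u ∷_) ws∈
  = insertions-All⁺ us ws′∈ (v≢u ∘ sym) u∉us ∷ insertions-distinct⁺ us ws′∈ v∉us us!

insertions-distinct⁻ : ∀ {v} (us : Vec A n) {ws} →
                       ws ∈ insertions v us → Unique ws → Unique us
insertions-distinct⁻ []       ws∈           ws!       = []
insertions-distinct⁻ (u ∷ us) (here ≡.refl) (_ ∷ us!) = us!
insertions-distinct⁻ (u ∷ us) (there ws∈)   ws!
  with _ , ws′∈ , ≡.refl ← ∈-map⁻ (u ∷_) ws∈ | u∉ws′ ∷ ws′! ← ws!
  = proj₂ (insertions-All⁻ us ws′∈ u∉ws′) ∷ insertions-distinct⁻ us ws′∈ ws′!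

zero∉raise : ∀ (π : Word m n) → All (zero ≢_) (raise π)
zero∉raise []      = []
zero∉raise (c ∷ π) = (λ ()) ∷ zero∉raise π

raise-distinct⁺ : ∀ {π : Word m n} → Unique π → Unique (raise π)
raise-distinct⁺ π! = VecAllPairs.map⁺ (VecAllPairs.map (_∘ Fin.suc-injective) π!)

raise-distinct⁻ : ∀ (π : Word m n) → Unique (raise π) → Unique π
raise-distinct⁻ []      []         = []
raise-distinct⁻ (c ∷ π) (c∉π ∷ π!) =
  All.map (_∘ cong suc) (All.map⁻ c∉π) ∷ raise-distinct⁻ π π!

vec-map-injective : ∀ {f : A → B} → (∀ {u v} → f u ≡ f v → u ≡ v) →
                    {us vs : Vec A n} → Vec.map f us ≡ Vec.map f vs → us ≡ vs
vec-map-injective f-inj {[]}     {[]}     _  = ≡.refl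
vec-map-injective f-inj {u ∷ us} {v ∷ vs} eq with fu≡fv , eq′ ← Vec.∷-injective eq =
  cong₂ _∷_ (f-inj fu≡fv) (vec-map-injective f-inj eq′)

insertMin-Unique : ∀ (π : Word m n) → List.Unique (insertMin π)
insertMin-Unique []      = [] ∷ []
insertMin-Unique (c ∷ π) =
  ListAll.map⁺ (ListAll.tabulate λ _ ()) ∷ List.map⁺ Vec.∷-injectiveʳ (insertMin-Unique π)

-- Raised words contain no `zero`, so the inserted letter can be located and deleted. The mixed
-- cases clash in the first letter, `zero` against a successor.
insertMin-injective : ∀ (ρ σ : Word m n) {π} → π ∈ insertMin ρ → π ∈ insertMin σ → ρ ≡ σ
insertMin-injective []      []      _             _             = ≡.refl
insertMin-injective (b ∷ ρ) (c ∷ σ) (here ≡.refl) (here π≡)     =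
  vec-map-injective Fin.suc-injective (Vec.∷-injectiveʳ π≡)
insertMin-injective (b ∷ ρ) (c ∷ σ) (here ≡.refl) (there π∈)
  with _ , _ , () ← ∈-map⁻ (suc c ∷_) π∈
insertMin-injective (b ∷ ρ) (c ∷ σ) (there π∈)    (here ≡.refl)
  with _ , _ , () ← ∈-map⁻ (suc b ∷_) π∈
insertMin-injective (b ∷ ρ) (c ∷ σ) (there π∈ρ)   (there π∈σ)
  with _ , ρ∈ , ≡.refl ← ∈-map⁻ (suc b ∷_) π∈ρ | _ , σ∈ , ≡.refl ← ∈-map⁻ (suc c ∷_) π∈σ
  = cong (_ ∷_) (insertMin-injective ρ σ ρ∈ σ∈)

-- Inverse to insertion: the minimum is either absent or was inserted into a raised word. Alphabet
-- size and length stay independent because passing to the tail shortens the word but keeps the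
-- alphabet.
data MinView {m} : ∀ {n} → Word (suc m) n → Set where
  positive : ∀ (ρ : Word m n) → MinView (raise ρ)
  inserted : ∀ (ρ : Word m n) {π} → π ∈ insertMin ρ → MinView π

minView : ∀ {π : Word (suc m) n} → Unique π → MinView π
minView {π = []}        []         = positive []
minView {π = c ∷ π}     (c∉π ∷ π!) with minView π!
minView {π = zero ∷ _}  (c∉π ∷ π!) | positive []      = inserted [] (here ≡.refl)
minView {π = zero ∷ _}  (c∉π ∷ π!) | positive (b ∷ ρ) = inserted (b ∷ ρ) (here ≡.refl)
minView {π = suc c ∷ _} (c∉π ∷ π!) | positive ρ       = positive (c ∷ ρ)
-- The tail already contains `zero`, so a leading `zero` would repeat it.
minView {π = zero ∷ _}  (c∉π ∷ π!) | inserted ρ π∈    =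
  contradiction ≡.refl (proj₁ (insertions-All⁻ _ π∈ c∉π))
minView {π = suc c ∷ _} (c∉π ∷ π!) | inserted ρ π∈    =
  inserted (c ∷ ρ) (there (∈-map⁺ (suc c ∷_) π∈))

-- Serves to exclude permutations without the minimum: lowered by one, their letters come from an
-- alphabet smaller than their length.
¬distinct-overlong : ∀ {π : Word n (suc n)} → ¬ Unique π
¬distinct-overlong {n} {π} π! with i , j , i<j , πᵢ≡πⱼ ← Fin.pigeonhole ℕ.≤-refl (lookup π) =
  Fin.<⇒≢ i<j (lookup-injective π! i j πᵢ≡πⱼ)

-- Generating all permutations by insertion of the minimum.

∈-words : ∀ (π : Word m n) → π ∈ words m n
∈-words []      = here ≡.refl
∈-words (c ∷ π) = ∈-cartesianProductWith⁺ _∷_ (∈-allFin c) (∈-words π)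

words-Unique : ∀ m n → List.Unique (words m n)
words-Unique m ℕ.zero  = [] ∷ []
words-Unique m (suc n) =
  List.cartesianProductWith⁺ _∷_ Vec.∷-injective (List.allFin⁺ m) (words-Unique m n)

distinct? : Decidable (Unique {A = Fin m} {n})
distinct? = allPairs? λ i j → ¬? (i Fin.≟ j)

∈-𝔖⁺ : {π : Word n n} → Unique π → π ∈ 𝔖 n
∈-𝔖⁺ {π = π} = ∈-filter⁺ distinct? (∈-words π)

∈-𝔖⁻ : {π : Word n n} → π ∈ 𝔖 n → Unique π
∈-𝔖⁻ π∈ = proj₂ (∈-filter⁻ distinct? {xs = words _ _} π∈)

𝔖-Unique : ∀ n → List.Unique (𝔖 n)
𝔖-Unique n = List.filter⁺ distinct? (words-Unique n n)

concatMap-Unique : ∀ (h : A → List B) {vs} → (∀ v → List.Unique (h v)) →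
                   (∀ {u v w} → w ∈ h u → w ∈ h v → u ≡ v) →
                   List.Unique vs → List.Unique (concatMap h vs)
concatMap-Unique h h! h-inj vs! = List.concat⁺ (ListAll.map⁺ (ListAll.tabulate λ {v} _ → h! v))
  (AllPairs.map⁺ (AllPairs.map disjoint vs!))
  where
  disjoint : ∀ {u v} → u ≢ v → Disjoint (h u) (h v)
  disjoint u≢v (w∈u , w∈v) = u≢v (h-inj w∈u w∈v)

-- Both lists are free of duplicates, so having the same members makes them rearrangements of each
-- other.
𝔖-suc : ∀ n → 𝔖 (suc n) ↭ concatMap insertMin (𝔖 n)
𝔖-suc n = ∼bag⇒↭ (unique∧set⇒bag (𝔖-Unique (suc n))
  (concatMap-Unique insertMin insertMin-Unique (insertMin-injective _ _) (𝔖-Unique n))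
  (mk⇔ to from))
  where
  to : ∀ {π} → π ∈ 𝔖 (suc n) → π ∈ concatMap insertMin (𝔖 n)
  to π∈ with π! ← ∈-𝔖⁻ π∈ | minView (∈-𝔖⁻ π∈)
  ... | positive ρ      = contradiction (raise-distinct⁻ ρ π!) ¬distinct-overlong
  ... | inserted ρ π∈ρ  = ∈-concatMap⁺ insertMin
    (lose (∈-𝔖⁺ (raise-distinct⁻ ρ (insertions-distinct⁻ _ π∈ρ π!))) π∈ρ)
  from : ∀ {π} → π ∈ concatMap insertMin (𝔖 n) → π ∈ 𝔖 (suc n)
  from π∈ with ρ , ρ∈ , π∈ρ ← find (∈-concatMap⁻ insertMin π∈) =
    ∈-𝔖⁺ (insertions-distinct⁺ _ π∈ρ (zero∉raise ρ) (raise-distinct⁺ (∈-𝔖⁻ ρ∈)))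

-- Direction changes and weights

data Direction : Set where
  up down : Direction

-- The Boolean comparison makes raising both letters leave the direction unchanged by computation,
-- and steps to and from `zero` evaluate at once. Equal letters count as `down`.
direction : Fin m → Fin m → Direction
direction b c = if toℕ b ℕ.<ᵇ toℕ c then up else down

letter : Direction → Direction → ℤ[ Letter ]
letter up   up   = z
letter up   down = y
letter down up   = y
letter down down = z

-- A scan of the word with a state: `b` is the letter just read and `d` the direction in which it
-- was reached. The letter for the step into `b` is not included.
weight : Direction → Fin m → Word m n → ℤ[ Letter ]
weight d b []      = ⟦ 1 ⟧
weight d b (c ∷ π) = letter d (direction b c) * weight (direction b c) c π

weight-raise : ∀ d (b : Fin m) (π : Word m n) → weight d (suc b) (raise π) ≡ weight d b π
weight-raise d b []      = ≡.refl
weight-raise d b (c ∷ π) = cong (letter d (direction b c) *_) (weight-raise (direction b c) c π)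

insertionWeight : Direction → Fin m → Word m n → ℤ[ Letter ]
insertionWeight d b π = ∑ (weight d (suc b)) (insertMin π)

-- The first summand places the minimum between `b` and `c`: a descent to it, then a turn `y`
-- upwards, so that `c` is now reached by an ascent. All other insertions happen behind `c`.
insertionWeight-∷ : ∀ d (b c : Fin m) (π : Word m n) →
                    insertionWeight d b (c ∷ π) ≈
                    letter d down * (y * weight up c π) +
                    letter d (direction b c) * insertionWeight (direction b c) c π
insertionWeight-∷ d b c π = +-cong
  (≈-reflexive (cong (λ w → letter d down * (y * w)) (weight-raise up c π)))
  (≈-trans (≈-reflexive (∑-map (weight d (suc b)) (suc c ∷_) (insertMin π)))
           (≈-sym (*-distribˡ-∑ (letter d (direction b c)) _ (insertMin π))))

-- If b is reached by a descent, y * weight up b π comes from inserting the minimum just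
-- before b: only together with this term do the insertions around a valley add up to a
-- derivative.
insertionWeight-up : ∀ (b : Fin m) (π : Word m n) →
                     insertionWeight up b π ≈ D (weight up b π) + y * weight up b π
insertionWeight-down : ∀ (b : Fin m) (π : Word m n) →
                       insertionWeight down b π + y * weight up b π ≈
                       D (weight down b π) + (y + z) * weight down b π

insertionWeight-up b []      = solve 1 (λ y → y ⊛ con 1 ⊕ con 0 := con 0 ⊕ y ⊛ con 1) ≈-refl y
insertionWeight-up b (c ∷ π) = ≈-trans (insertionWeight-∷ up b c π) step
  where
  step : y * (y * weight up c π) +
         letter up (direction b c) * insertionWeight (direction b c) c π ≈
         D (weight up b (c ∷ π)) + y * weight up b (c ∷ π)
  step with direction b c
  -- An insertion into the ascent from `b` to `c` replaces its letter `z` by `y ^ 2`, which is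
  -- `D z`.
  ... | up   = ≈-trans (+-congˡ (*-congˡ (insertionWeight-up c π)))
    (solve 4 (λ y z w w′ → y ⊛ (y ⊛ w) ⊕ z ⊛ (w′ ⊕ y ⊛ w) :=
                           (y :^ 2 ⊛ w ⊕ z ⊛ w′) ⊕ y ⊛ (z ⊛ w)) ≈-refl y z _ _)
  -- The insertion just before `c` supplies the extra term in the rule for a letter reached by a
  -- descent.
  ... | down = ≈-trans
    (solve 3 (λ y v i → y ⊛ (y ⊛ v) ⊕ y ⊛ i := y ⊛ (i ⊕ y ⊛ v)) ≈-refl y _ _)
    (≈-trans (*-congˡ (insertionWeight-down c π))
    (solve 4 (λ y z w w′ → y ⊛ (w′ ⊕ (y ⊕ z) ⊛ w) :=
                           (y ⊛ z ⊛ w ⊕ y ⊛ w′) ⊕ y ⊛ (y ⊛ w)) ≈-refl y z _ _))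

insertionWeight-down b []      =
  solve 2 (λ y z → (z ⊛ con 1 ⊕ con 0) ⊕ y ⊛ con 1 := con 0 ⊕ (y ⊕ z) ⊛ con 1) ≈-refl y z
insertionWeight-down b (c ∷ π) = ≈-trans (+-congʳ (insertionWeight-∷ down b c π)) step
  where
  step : (z * (y * weight up c π) +
          letter down (direction b c) * insertionWeight (direction b c) c π) +
         y * weight up b (c ∷ π) ≈
         D (weight down b (c ∷ π)) + (y + z) * weight down b (c ∷ π)
  step with direction b c
  ... | up   = ≈-trans (+-congʳ (+-congˡ (*-congˡ (insertionWeight-up c π))))
    (solve 4 (λ y z w w′ → (z ⊛ (y ⊛ w) ⊕ y ⊛ (w′ ⊕ y ⊛ w)) ⊕ y ⊛ (z ⊛ w) :=
                           (y ⊛ z ⊛ w ⊕ y ⊛ w′) ⊕ (y ⊕ z) ⊛ (y ⊛ w)) ≈-refl y z _ _)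
  ... | down = ≈-trans
    (solve 5 (λ y z v w i → (z ⊛ (y ⊛ v) ⊕ z ⊛ i) ⊕ y ⊛ (y ⊛ w) :=
                            z ⊛ (i ⊕ y ⊛ v) ⊕ y ⊛ (y ⊛ w)) ≈-refl y z _ _ _)
    (≈-trans (+-congʳ (*-congˡ (insertionWeight-down c π)))
    (solve 4 (λ y z w w′ → z ⊛ (w′ ⊕ (y ⊕ z) ⊛ w) ⊕ y ⊛ (y ⊛ w) :=
                           (y :^ 2 ⊛ w ⊕ z ⊛ w′) ⊕ (y ⊕ z) ⊛ (z ⊛ w)) ≈-refl y z _ _))

-- Insertion rules for the weights of whole words.

fallingWeight : Word m n → ℤ[ Letter ]
fallingWeight []      = ⟦ 1 ⟧
fallingWeight (b ∷ π) = y * weight up b π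

runWeight : Word m n → ℤ[ Letter ]
runWeight []          = ⟦ 1 ⟧
runWeight (b ∷ [])    = ⟦ 1 ⟧
runWeight (b ∷ c ∷ π) = y * weight (direction b c) c π

-- A minimum in front turns the entry letter `y` into `y * z`, which is `D y`; the remaining
-- positions are covered by the rule after an ascent.
fallingWeight-insertMin : ∀ (π : Word m n) →
  ∑ fallingWeight (insertMin π) ≈ D (fallingWeight π) + y * fallingWeight π
fallingWeight-insertMin []      =
  solve 1 (λ y → y ⊛ con 1 ⊕ con 0 := con 0 ⊕ y ⊛ con 1) ≈-refl y
fallingWeight-insertMin (b ∷ π) = begin
  y * (z * weight up (suc b) (raise π)) + ∑ fallingWeight (map (suc b ∷_) (insertMin π))
    ≈⟨ +-cong (≈-reflexive (cong (λ w → y * (z * w)) (weight-raise up b π)))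
              (≈-trans (≈-reflexive (∑-map fallingWeight (suc b ∷_) (insertMin π)))
                       (≈-sym (*-distribˡ-∑ y (weight up (suc b)) (insertMin π)))) ⟩
  y * (z * weight up b π) + y * insertionWeight up b π
    ≈⟨ +-congˡ (*-congˡ (insertionWeight-up b π)) ⟩
  y * (z * weight up b π) + y * (D (weight up b π) + y * weight up b π)
    ≈⟨ solve 4 (λ y z w w′ → y ⊛ (z ⊛ w) ⊕ y ⊛ (w′ ⊕ y ⊛ w) :=
                             (y ⊛ z ⊛ w ⊕ y ⊛ w′) ⊕ y ⊛ (y ⊛ w)) ≈-refl y z _ _ ⟩
  D (y * weight up b π) + y * (y * weight up b π)
    ∎

-- The positions before and directly after the first letter are treated separately, since they
-- change the first step. If the word starts with an ascent, they give `D y` and one of the two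
-- factors `y`, and the later positions give the other.
runWeight-insertMin : ∀ (π : Word m (suc n)) →
  ∑ runWeight (insertMin π) ≈ D (runWeight π) + (y + y) * runWeight π
runWeight-insertMin (b ∷ [])    =
  solve 1 (λ y → y ⊛ con 1 ⊕ (y ⊛ con 1 ⊕ con 0) := con 0 ⊕ (y ⊕ y) ⊛ con 1) ≈-refl y
runWeight-insertMin (b ∷ c ∷ π) = begin
  y * weight up (suc b) (raise (c ∷ π)) + (y * (y * weight up (suc c) (raise π)) +
  ∑ runWeight (map (suc b ∷_) (map (suc c ∷_) (insertMin π))))
    ≈⟨ +-cong (≈-reflexive (cong (y *_) (weight-raise up b (c ∷ π))))
      (+-cong (≈-reflexive (cong (λ w → y * (y * w)) (weight-raise up c π)))
        (≈-trans (≈-reflexive (≡.trans (∑-map runWeight (suc b ∷_) (map (suc c ∷_) (insertMin π)))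
                                       (∑-map _ (suc c ∷_) (insertMin π))))
                 (≈-sym (*-distribˡ-∑ y (weight (direction b c) (suc c)) (insertMin π))))) ⟩
  y * weight up b (c ∷ π) +
  (y * (y * weight up c π) + y * insertionWeight (direction b c) c π)
    ≈⟨ step ⟩
  D (y * weight (direction b c) c π) + (y + y) * (y * weight (direction b c) c π)
    ∎
  where
  step : y * weight up b (c ∷ π) +
         (y * (y * weight up c π) + y * insertionWeight (direction b c) c π) ≈
         D (y * weight (direction b c) c π) + (y + y) * (y * weight (direction b c) c π)
  step with direction b c
  ... | up   = ≈-trans (+-congˡ (+-congˡ (*-congˡ (insertionWeight-up c π))))
    (solve 4 (λ y z w w′ → y ⊛ (z ⊛ w) ⊕ (y ⊛ (y ⊛ w) ⊕ y ⊛ (w′ ⊕ y ⊛ w)) :=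
                           (y ⊛ z ⊛ w ⊕ y ⊛ w′) ⊕ (y ⊕ y) ⊛ (y ⊛ w)) ≈-refl y z _ _)
  ... | down = ≈-trans
    (solve 4 (λ y v w i → y ⊛ (y ⊛ w) ⊕ (y ⊛ (y ⊛ v) ⊕ y ⊛ i) :=
                          y ⊛ (y ⊛ w) ⊕ y ⊛ (i ⊕ y ⊛ v)) ≈-refl y _ _ _)
    (≈-trans (+-congˡ (*-congˡ (insertionWeight-down c π)))
    (solve 4 (λ y z w w′ → y ⊛ (y ⊛ w) ⊕ y ⊛ (w′ ⊕ (y ⊕ z) ⊛ w) :=
                           (y ⊛ z ⊛ w ⊕ y ⊛ w′) ⊕ (y ⊕ y) ⊛ (y ⊛ w)) ≈-refl y z _ _))

-- Iterated derivatives as sums of weights.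

∑-𝔖-suc : ∀ n p (f : ∀ {m} → Word m m → ℤ[ Letter ]) →
          (∀ (π : Word n n) → ∑ f (insertMin π) ≈ D (f π) + p * f π) →
          ∑ f (𝔖 (suc n)) ≈ D (∑ f (𝔖 n)) + p * ∑ f (𝔖 n)
∑-𝔖-suc n p f rule = begin
  ∑ f (𝔖 (suc n))                     ≈⟨ ∑-↭ f (𝔖-suc n) ⟩
  ∑ f (concatMap insertMin (𝔖 n))     ≈⟨ ∑-concatMap f insertMin (𝔖 n) ⟩
  ∑ (λ π → ∑ f (insertMin π)) (𝔖 n)   ≈⟨ ∑-cong (𝔖 n) (λ {π} _ → rule π) ⟩
  ∑ (λ π → D (f π) + p * f π) (𝔖 n)   ≈⟨ D-∑ p f (𝔖 n) ⟩
  D (∑ f (𝔖 n)) + p * ∑ f (𝔖 n)       ∎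

D^[n]x : ∀ n → D^[ n ] x ≈ x * ∑ fallingWeight (𝔖 n)
D^[n]x ℕ.zero  = solve 1 (λ x → x := x ⊛ (con 1 ⊕ con 0)) ≈-refl x
D^[n]x (suc n) = begin
  D (D^[ n ] x)
    ≈⟨ derivative-cong G (D^[n]x n) ⟩
  D (x * S)
    ≈⟨ solve 4 (λ x y s s′ → x ⊛ y ⊛ s ⊕ x ⊛ s′ := x ⊛ (s′ ⊕ y ⊛ s)) ≈-refl x y _ _ ⟩
  x * (D S + y * S)
    ≈⟨ *-congˡ (∑-𝔖-suc n y fallingWeight fallingWeight-insertMin) ⟨
  x * ∑ fallingWeight (𝔖 (suc n))
    ∎
  where S = ∑ fallingWeight (𝔖 n)

-- The size is shifted because a word of `suc n` letters has `n` steps; the induction starts from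
-- the one-letter permutation, of weight 1.
D^[n]x² : ∀ n → D^[ n ] (x ^ 2) ≈ x ^ 2 * ∑ runWeight (𝔖 (suc n))
D^[n]x² ℕ.zero  = solve 1 (λ x → x :^ 2 := x :^ 2 ⊛ (con 1 ⊕ con 0)) ≈-refl x
D^[n]x² (suc n) = begin
  D (D^[ n ] (x ^ 2))
    ≈⟨ derivative-cong G (D^[n]x² n) ⟩
  D (x ^ 2 * S)
    -- `x ^ 2` unfolds to `x * (x * 1)`, so its derivative also contains the derivative 0 of the
    -- constant 1.
    ≈⟨ solve 4 (λ x y s s′ →
         (x ⊛ y ⊛ (x ⊛ con 1) ⊕ x ⊛ (x ⊛ y ⊛ con 1 ⊕ x ⊛ con 0)) ⊛ s ⊕ x :^ 2 ⊛ s′ :=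
         x :^ 2 ⊛ (s′ ⊕ (y ⊕ y) ⊛ s)) ≈-refl x y _ _ ⟩
  x ^ 2 * (D S + (y + y) * S)
    ≈⟨ *-congˡ (∑-𝔖-suc (suc n) (y + y) runWeight runWeight-insertMin) ⟨
  x ^ 2 * ∑ runWeight (𝔖 (suc (suc n)))
    ∎
  where S = ∑ runWeight (𝔖 (suc n))

-- Counting turns: exponents of the weights, and alternating runs.

data Step (b c : Fin m) : Direction → Set where
  ascent  : toℕ b ℕ.< toℕ c → Step b c up
  descent : toℕ c ℕ.≤ toℕ b → Step b c down

-- Matching on this together with `direction b c` fixes the computed direction and yields the
-- inequality behind it.
step : ∀ (b c : Fin m) → Step b c (direction b c)
step b c with toℕ b ℕ.<ᵇ toℕ c | ℕ.<ᵇ-reflects-< (toℕ b) (toℕ c)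
... | true  | ofʸ b<c = ascent b<c
... | false | ofⁿ b≮c = descent (ℕ.≮⇒≥ b≮c)

descent-< : ∀ {b c : Fin m} → b ≢ c → toℕ c ℕ.≤ toℕ b → toℕ c ℕ.< toℕ b
descent-< b≢c c≤b = ℕ.≤∧≢⇒< c≤b (b≢c ∘ sym ∘ Fin.toℕ-injective)

turn : Direction → Direction → ℕ
turn up   up   = 0
turn up   down = 1
turn down up   = 1
turn down down = 0

turns : Direction → Fin m → Word m n → ℕ
turns d b []      = 0
turns d b (c ∷ π) = turn d (direction b c) ℕ.+ turns (direction b c) c π

turn≤1 : ∀ d e → turn d e ℕ.≤ 1
turn≤1 up   up   = ℕ.z≤n
turn≤1 up   down = ℕ.≤-refl
turn≤1 down up   = ℕ.≤-refl
turn≤1 down down = ℕ.z≤n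

turns≤n : ∀ d (b : Fin m) (π : Word m n) → turns d b π ℕ.≤ n
turns≤n d b []      = ℕ.z≤n
turns≤n d b (c ∷ π) = ℕ.+-mono-≤ (turn≤1 d (direction b c)) (turns≤n (direction b c) c π)

monomial : ℕ → ℕ → ℤ[ Letter ]
monomial n k = y ^ k * z ^ (n ∸ k)

letter-turn : ∀ d e → letter d e ≈ monomial 1 (turn d e)
letter-turn up   up   = solve 1 (λ z → z := con 1 ⊛ (z ⊛ con 1)) ≈-refl z
letter-turn up   down = solve 1 (λ y → y := y ⊛ con 1 ⊛ con 1) ≈-refl y
letter-turn down up   = solve 1 (λ y → y := y ⊛ con 1 ⊛ con 1) ≈-refl y
letter-turn down down = solve 1 (λ z → z := con 1 ⊛ (z ⊛ con 1)) ≈-refl z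

-- The bounds keep the subtractions from being truncated.
∸-+-interchange : ∀ {i j m n} → i ℕ.≤ m → j ℕ.≤ n → (m ∸ i) ℕ.+ (n ∸ j) ≡ (m ℕ.+ n) ∸ (i ℕ.+ j)
∸-+-interchange {i} {j} {m} {n} i≤m j≤n = ≡.trans (sym (ℕ.+-∸-assoc (m ∸ i) j≤n))
  (≡.trans (cong (_∸ j) (sym (ℕ.+-∸-comm n i≤m))) (ℕ.∸-+-assoc (m ℕ.+ n) i j))

-- Each of the `n` steps contributes one letter, `y` at a turn and `z` otherwise, so the exponents
-- add up to `n`.
weight≈monomial : ∀ d (b : Fin m) (π : Word m n) →
                  weight d b π ≈ monomial n (turns d b π)
weight≈monomial d b []              = solve 0 (con 1 := con 1 ⊛ con 1) ≈-refl
weight≈monomial {n = suc n} d b (c ∷ π) = begin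
  letter d e * weight e c π
    ≈⟨ *-cong (letter-turn d e) (weight≈monomial e c π) ⟩
  (y ^ i * z ^ (1 ∸ i)) * (y ^ j * z ^ (n ∸ j))
    ≈⟨ solve 4 (λ p q r s → (p ⊛ q) ⊛ (r ⊛ s) := (p ⊛ r) ⊛ (q ⊛ s)) ≈-refl _ _ _ _ ⟩
  (y ^ i * y ^ j) * (z ^ (1 ∸ i) * z ^ (n ∸ j))
    ≈⟨ *-cong (^-homo-* y i j) (^-homo-* z (1 ∸ i) (n ∸ j)) ⟨
  y ^ (i ℕ.+ j) * z ^ ((1 ∸ i) ℕ.+ (n ∸ j))
    ≈⟨ *-congˡ (≈-reflexive (cong (z ^_) (∸-+-interchange (turn≤1 d e) (turns≤n e c π)))) ⟩
  y ^ (i ℕ.+ j) * z ^ (suc n ∸ (i ℕ.+ j))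
    ∎
  where
  e = direction b c
  i = turn d e
  j = turns e c π

-- Distinctness matters at neighbours: `direction` reads a tie as a descent, whereas
-- `ChangesDirection` asks for strict inequalities.
alternatingRuns≡ : ∀ (b c : Fin m) (π : Word m n) → Unique (b ∷ c ∷ π) →
                   alternatingRuns (b ∷ c ∷ π) ≡ suc (turns (direction b c) c π)
alternatingRuns≡ b c π π! = cong suc (changes b c π π!)
  where
  turn≡ : ∀ {m n} (b c d : Fin m) (π : Word m n) → b ≢ c → c ≢ d →
          indicator (changesDirection? (b ∷ c ∷ d ∷ π) zero) ≡
          turn (direction b c) (direction c d)
  turn≡ b c d π b≢c c≢d with direction b c | step b c | direction c d | step c d
  ... | _ | ascent b<c  | _ | ascent c<d  = cong (if_then 1 else 0) (dec-false
    (changesDirection? (b ∷ c ∷ d ∷ π) zero)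
    λ { (inj₁ (_ , c>d)) → ℕ.<-asym c<d c>d ; (inj₂ (b>c , _)) → ℕ.<-asym b<c b>c })
  ... | _ | ascent b<c  | _ | descent d≤c = cong (if_then 1 else 0) (dec-true
    (changesDirection? (b ∷ c ∷ d ∷ π) zero) (inj₁ (b<c , descent-< c≢d d≤c)))
  ... | _ | descent c≤b | _ | ascent c<d  = cong (if_then 1 else 0) (dec-true
    (changesDirection? (b ∷ c ∷ d ∷ π) zero) (inj₂ (descent-< b≢c c≤b , c<d)))
  ... | _ | descent c≤b | _ | descent d≤c = cong (if_then 1 else 0) (dec-false
    (changesDirection? (b ∷ c ∷ d ∷ π) zero)
    λ { (inj₁ (b<c , _)) → ℕ.≤⇒≯ c≤b b<c ; (inj₂ (_ , c<d)) → ℕ.≤⇒≯ d≤c c<d })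

  changes : ∀ {m n} (b c : Fin m) (π : Word m n) → Unique (b ∷ c ∷ π) →
            count (changesDirection? (b ∷ c ∷ π)) (allFin n) ≡ turns (direction b c) c π
  changes b c []              _  = ≡.refl
  changes {n = suc n} b c (d ∷ π) ((b≢c ∷ _) ∷ π!@((c≢d ∷ _) ∷ _)) =
    -- The first interior position is split off; the others are shifted by one and belong to the
    -- word without `b`.
    ≡.trans (count-∷ P? zero (tabulate suc))
    (cong₂ ℕ._+_ (turn≡ b c d π b≢c c≢d)
      (≡.trans (cong (count P?) (sym (map-tabulate id suc)))
      (≡.trans (count-map P? suc (allFin n)) (changes c d π π!))))
    where P? = changesDirection? (b ∷ c ∷ d ∷ π)

-- Longest alternating subsequences

falling-tail : ∀ {b : Fin m} bs → Falling (b ∷ bs) → Rising bs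
falling-tail []       _ = tt
falling-tail (_ ∷ bs) f = proj₂ f

rising-tail : ∀ {b : Fin m} bs → Rising (b ∷ bs) → Falling bs
rising-tail []       _ = tt
rising-tail (_ ∷ bs) r = proj₂ r

-- An exchange argument along the word. On an ascent from `b`, a falling subsequence can be moved
-- behind `b` without loss of length; on a descent, deleting its first entry leaves a rising one
-- behind `b`, and the turn pays for the deleted entry.
falling-length : ∀ (b : Fin m) (π : Word m n) {bs} →
                 bs ⊆ b ∷ toList π → Falling bs → length bs ℕ.≤ suc (turns up b π)
rising-length  : ∀ (b : Fin m) (π : Word m n) {bs} →
                 bs ⊆ b ∷ toList π → Rising bs → length bs ℕ.≤ suc (turns down b π)

falling-length b []      bs⊆ f = length-mono-≤ bs⊆
falling-length b (c ∷ π) bs⊆ f with direction b c | step b c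
falling-length b (c ∷ π) (_ ∷ʳ bs⊆)      f | _ | ascent b<c  = falling-length c π bs⊆ f
falling-length b (c ∷ π) {_ ∷ []} (≡.refl ∷ bs⊆) f | _ | ascent b<c = ℕ.s≤s ℕ.z≤n
falling-length b (c ∷ π) (≡.refl ∷ ≡.refl ∷ bs⊆) f | _ | ascent b<c =
  contradiction b<c (ℕ.<-asym (proj₁ f))
-- Replacing the leading b by the larger c keeps the subsequence falling.
falling-length b (c ∷ π) {_ ∷ _ ∷ _} (≡.refl ∷ _ ∷ʳ bs⊆) (b>d , r) | _ | ascent b<c =
  falling-length c π (≡.refl ∷ bs⊆) (ℕ.<-trans b>d b<c , r)
falling-length b (c ∷ π) {[]}     bs⊆            f | _ | descent _ = ℕ.z≤n
falling-length b (c ∷ π) {_ ∷ bs} (_ ∷ʳ bs⊆)     f | _ | descent _ =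
  ℕ.s≤s (rising-length c π (∷ˡ⁻ bs⊆) (falling-tail bs f))
falling-length b (c ∷ π) {_ ∷ bs} (≡.refl ∷ bs⊆) f | _ | descent _ =
  ℕ.s≤s (rising-length c π bs⊆ (falling-tail bs f))

rising-length b []      bs⊆ r = length-mono-≤ bs⊆
rising-length b (c ∷ π) bs⊆ r with direction b c | step b c
rising-length b (c ∷ π) (_ ∷ʳ bs⊆)      r | _ | descent c≤b  = rising-length c π bs⊆ r
rising-length b (c ∷ π) {_ ∷ []} (≡.refl ∷ bs⊆) r | _ | descent c≤b = ℕ.s≤s ℕ.z≤n
rising-length b (c ∷ π) (≡.refl ∷ ≡.refl ∷ bs⊆) r | _ | descent c≤b =
  contradiction (proj₁ r) (ℕ.≤⇒≯ c≤b)
rising-length b (c ∷ π) {_ ∷ _ ∷ _} (≡.refl ∷ _ ∷ʳ bs⊆) (b<d , f) | _ | descent c≤b =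
  rising-length c π (≡.refl ∷ bs⊆) (ℕ.≤-<-trans c≤b b<d , f)
rising-length b (c ∷ π) {[]}     bs⊆            r | _ | ascent _ = ℕ.z≤n
rising-length b (c ∷ π) {_ ∷ bs} (_ ∷ʳ bs⊆)     r | _ | ascent _ =
  ℕ.s≤s (falling-length c π (∷ˡ⁻ bs⊆) (rising-tail bs r))
rising-length b (c ∷ π) {_ ∷ bs} (≡.refl ∷ bs⊆) r | _ | ascent _ =
  ℕ.s≤s (falling-length c π bs⊆ (rising-tail bs r))

-- A greedy choice: `b` is skipped on an ascent and kept on a descent. The bound `toℕ b ℕ.≤ toℕ c`
-- on the first chosen letter is what allows an earlier, smaller letter to be put in front.
longest-falling : ∀ (b : Fin m) (π : Word m n) → Unique (b ∷ π) → ∃₂ λ c bs →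
                  c ∷ bs ⊆ b ∷ toList π × Falling (c ∷ bs) ×
                  toℕ b ℕ.≤ toℕ c × length bs ≡ turns up b π
longest-rising  : ∀ (b : Fin m) (π : Word m n) → Unique (b ∷ π) → ∃₂ λ c bs →
                  c ∷ bs ⊆ b ∷ toList π × Rising (c ∷ bs) ×
                  toℕ c ℕ.≤ toℕ b × length bs ≡ turns down b π

longest-falling b []      _ = b , [] , ≡.refl ∷ [] , tt , ℕ.≤-refl , ≡.refl
longest-falling b (c ∷ π) ((b≢c ∷ _) ∷ π!) with direction b c | step b c
... | _ | ascent b<c with d , bs , bs⊆ , f , c≤d , len ← longest-falling c π π! =
  d , bs , b ∷ʳ bs⊆ , f , ℕ.≤-trans (ℕ.<⇒≤ b<c) c≤d , len
... | _ | descent c≤b with d , bs , bs⊆ , r , d≤c , len ← longest-rising c π π! =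
  b , d ∷ bs , ≡.refl ∷ bs⊆ , (ℕ.≤-<-trans d≤c (descent-< b≢c c≤b) , r) , ℕ.≤-refl , cong suc len

longest-rising b []      _ = b , [] , ≡.refl ∷ [] , tt , ℕ.≤-refl , ≡.refl
longest-rising b (c ∷ π) ((b≢c ∷ _) ∷ π!) with direction b c | step b c
... | _ | descent c≤b with d , bs , bs⊆ , r , d≤c , len ← longest-rising c π π! =
  d , bs , b ∷ʳ bs⊆ , r , ℕ.≤-trans d≤c c≤b , len
... | _ | ascent b<c with d , bs , bs⊆ , f , c≤d , len ← longest-falling c π π! =
  b , d ∷ bs , ≡.refl ∷ bs⊆ , (ℕ.<-≤-trans b<c c≤d , f) , ℕ.≤-refl , cong suc len

as≡ : ∀ (b : Fin m) (π : Word m n) → Unique (b ∷ π) → as (b ∷ π) ≡ suc (turns up b π)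
as≡ b π π! with c , bs , bs⊆ , f , _ , len ← longest-falling b π π! = max≈v⁺
  (≡.subst (λ l → l ∈ lengths) (cong suc len)
    (∈-map⁺ length (∈-filter⁺ falling? (∈-subsequences⁺ bs⊆) f)))
  (ListAll.map⁺ (ListAll.tabulate bounded))
  -- The default value 0 of `max` lies below the claimed maximum.
  ℕ.z≤n
  where
  lengths = map length (filter falling? (subsequences (toList (b ∷ π))))
  bounded : ∀ {bs} → bs ∈ filter falling? (subsequences (toList (b ∷ π))) →
            length bs ℕ.≤ suc (turns up b π)
  bounded bs∈ with bs∈′ , f ← ∈-filter⁻ falling? {xs = subsequences (toList (b ∷ π))} bs∈ =
    falling-length b π (∈-subsequences⁻ _ bs∈′) f

-- Reading off the coefficients.

fallingWeight≈ : ∀ {π : Word m (suc n)} → Unique π → fallingWeight π ≈ monomial (suc n) (as π)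
fallingWeight≈ {n = n} {b ∷ π} π! = begin
  y * weight up b π                      ≈⟨ *-congˡ (weight≈monomial up b π) ⟩
  -- `suc n ∸ suc k` computes to `n ∸ k`, so the extra `y` raises only the exponent of `y`.
  y * monomial n (turns up b π)          ≈⟨ *-assoc y _ _ ⟨
  monomial (suc n) (suc (turns up b π))  ≡⟨ cong (monomial (suc n)) (as≡ b π π!) ⟨
  monomial (suc n) (as (b ∷ π))          ∎

runWeight≈ : ∀ {π : Word m (suc (suc n))} → Unique π →
             runWeight π ≈ monomial (suc n) (alternatingRuns π)
runWeight≈ {n = n} {b ∷ c ∷ π} π! = begin
  y * weight d c π                                ≈⟨ *-congˡ (weight≈monomial d c π) ⟩
  y * monomial n (turns d c π)                    ≈⟨ *-assoc y _ _ ⟨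
  monomial (suc n) (suc (turns d c π))
    ≡⟨ cong (monomial (suc n)) (alternatingRuns≡ b c π π!) ⟨
  monomial (suc n) (alternatingRuns (b ∷ c ∷ π))  ∎
  where d = direction b c

-- There are at most as many turns as steps, which places both statistics in the summation range.
turns-index : ∀ d (b : Fin m) (π : Word m n) {s : ℕ} → s ≡ suc (turns d b π) →
              ∃ λ (j : Fin (suc n)) → s ≡ suc (toℕ j)
turns-index d b π s≡ = fromℕ< (ℕ.s≤s (turns≤n d b π)) ,
                       ≡.trans s≡ (cong suc (sym (Fin.toℕ-fromℕ< _)))

∑-monomial : ∀ n (s : A → ℕ) vs → (∀ {v} → v ∈ vs → ∃ λ (j : Fin n) → s v ≡ suc (toℕ j)) →
  ∑ (monomial n ∘ s) vs ≈
  (∑[1≤k≤ n ] λ k → ⟦ count (λ v → s v ℕ.≟ k) vs ⟧ * y ^ k * z ^ (n ∸ k))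
∑-monomial n s vs range = ≈-trans (∑-by-value n (monomial n) s vs range)
  (sum-cong-≋ {n} λ i → let k = suc (toℕ i) in
    ≈-sym (*-assoc ⟦ count (λ v → s v ℕ.≟ k) vs ⟧ (y ^ k) (z ^ (n ∸ k))))

∑-fallingWeight : ∀ n → let N = suc n in
  ∑ fallingWeight (𝔖 N) ≈ (∑[1≤k≤ N ] λ k → ⟦ a k N ⟧ * y ^ k * z ^ (N ∸ k))
∑-fallingWeight n = ≈-trans (∑-cong (𝔖 N) (fallingWeight≈ ∘ ∈-𝔖⁻))
                            (∑-monomial N as (𝔖 N) (index ∘ ∈-𝔖⁻))
  where
  N = suc n
  index : {π : Word N N} → Unique π → ∃ λ (j : Fin N) → as π ≡ suc (toℕ j)
  index {b ∷ π} π! = turns-index up b π (as≡ b π π!)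

∑-runWeight : ∀ n → let N = suc n in
  ∑ runWeight (𝔖 (suc N)) ≈ (∑[1≤k≤ N ] λ k → ⟦ R (suc N) k ⟧ * y ^ k * z ^ (N ∸ k))
∑-runWeight n = ≈-trans (∑-cong (𝔖 (suc N)) (runWeight≈ ∘ ∈-𝔖⁻))
                        (∑-monomial N alternatingRuns (𝔖 (suc N)) (index ∘ ∈-𝔖⁻))
  where
  N = suc n
  index : {π : Word (suc N) (suc N)} → Unique π →
          ∃ λ (j : Fin N) → alternatingRuns π ≡ suc (toℕ j)
  index {b ∷ c ∷ π} π! = turns-index (direction b c) c π (alternatingRuns≡ b c π π!)

theorem6 : ∀ (n : ℕ) → n ≥ 1 →
    (D^[ n ] (x ^ 2) ≈ x ^ 2 * (∑[1≤k≤ n ] (λ k → ⟦ R (suc n) k ⟧ * y ^ k * z ^ (n ∸ k))))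
    × (D^[ n ] x ≈ x * (∑[1≤k≤ n ] (λ k → ⟦ a k n ⟧ * y ^ k * z ^ (n ∸ k))))
-- With `n` a successor the words counted by `a` are nonempty, so `as` starts at 1 like the
-- summation index.
theorem6 n@(suc m) _ = ≈-trans (D^[n]x² n) (*-congˡ (∑-runWeight m)) ,
                       ≈-trans (D^[n]x n) (*-congˡ (∑-fallingWeight m))
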